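{- Let $H$ be a connected non-trivial core graph with at least $3$ and at most $7$ vertices. Then $H$ is projective if and only if $H$ is indecomposable.
   Context: Graphs are finite, simple, undirected, loopless. A homomorphism $f:G\to H$ is a map $V_G\to V_H$ sending edges to edges. $H$ is a core if every homomorphism $H\to H$ is bijective. The cross (direct) product $G\times H$ has vertex set $V_G\times V_H$ and $((u_1,v_1),(u_2,v_2))$ is an edge iff $(u_1,u_2)\in E_G$ and $(v_1,v_2)\in E_H$; $H^m$ is the $m$-fold product. An $m$-ary polymorphism of $H$ is a homomorphism $H^m\to H$; it is idempotent if $f(x,\dots,x)=x$ for all $x$. $H$ is projective if every idempotent polymorphism of $H$ is a projection $(x_1,\dots,x_m)\mapsto x_i$. $H$ is decomposable if $H$ is isomorphic to $H_1\times H_2$ for non-trivial graphs $H_1,H_2$ (each with more than one vertex), and indecomposable otherwise. (This is the Okrasa–Rzążewski conjecture restricted to graphs on at most 7 vertices.) -}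

module Defs where

open import Data.Nat using (ℕ; suc)
open import Data.Fin using (Fin; zero)
open import Data.Bool using (Bool; true)
open import Data.Product using (Σ; ∃; ∃-syntax; _×_; _,_; proj₁; proj₂)
open import Relation.Binary.PropositionalEquality using (_≡_)
open import Relation.Nullary using (¬_)
open import Function.Definitions using (Bijective)

record Graph : Set₁ where
  field
    V      : Set
    E      : V → V → Set
    E-sym  : ∀ {x y} → E x y → E y x
    E-irr  : ∀ {x} → ¬ E x x
open Graph public

record FinGraph (n : ℕ) : Set where
  field
    adj     : Fin n → Fin n → Bool
    adj-sym : ∀ x y → adj x y ≡ adj y x
    adj-irr : ∀ x → ¬ (adj x x ≡ true)
open FinGraph public

toGraph : ∀ {n} → FinGraph n → Graph
toGraph {n} G = record
  { V = Fin n
  ; E = λ x y → adj G x y ≡ true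
  ; E-sym = λ {x} {y} e → Relation.Binary.PropositionalEquality.trans (adj-sym G y x) e
  ; E-irr = λ {x} → adj-irr G x
  }
  where import Relation.Binary.PropositionalEquality

record Hom (G H : Graph) : Set where
  field
    fun  : V G → V H
    pres : ∀ {x y} → E G x y → E H (fun x) (fun y)
open Hom public

Core : Graph → Set
Core H = (f : Hom H H) → Bijective _≡_ _≡_ (fun f)

_⊗_ : Graph → Graph → Graph
G ⊗ H = record
  { V = V G × V H
  ; E = λ p q → E G (proj₁ p) (proj₁ q) × E H (proj₂ p) (proj₂ q)
  ; E-sym = λ (e₁ , e₂) → E-sym G e₁ , E-sym H e₂
  ; E-irr = λ (e₁ , _) → E-irr G e₁
  }

-- m-fold cross product H^m for m ≥ 1 (written with m = suc k):
-- vertices are m-tuples, edges coordinatewise.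
-- (H^0 would be a single looped vertex, not a loopless graph.)
_^⁺_ : Graph → ℕ → Graph
H ^⁺ k = record
  { V = Fin (suc k) → V H
  ; E = λ x y → ∀ i → E H (x i) (y i)
  ; E-sym = λ e i → E-sym H (e i)
  ; E-irr = λ e → E-irr H (e zero)
  }

Idempotent : ∀ {H k} → Hom (H ^⁺ k) H → Set
Idempotent {H} {k} f = ∀ (x : V H) → fun f (λ _ → x) ≡ x

IsProjection : ∀ {H k} → Hom (H ^⁺ k) H → Set
IsProjection {H} {k} f = ∃[ i ] (∀ (x : Fin (suc k) → V H) → fun f x ≡ x i)

Projective : Graph → Set
Projective H = ∀ (k : ℕ) (f : Hom (H ^⁺ k) H) → Idempotent f → IsProjection f

record Iso (G H : Graph) : Set where
  field
    iso      : V G → V H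
    iso-bij  : Bijective _≡_ _≡_ iso
    iso-pres : ∀ {x y} → E G x y → E H (iso x) (iso y)
    iso-refl : ∀ {x y} → E H (iso x) (iso y) → E G x y

NonTrivial : Graph → Set
NonTrivial G = Σ (V G) λ x → Σ (V G) λ y → ¬ (x ≡ y)

Decomposable : Graph → Set₁
Decomposable H = ∃[ H₁ ] ∃[ H₂ ] (NonTrivial H₁ × NonTrivial H₂ × Iso H (H₁ ⊗ H₂))

Indecomposable : Graph → Set₁
Indecomposable H = ¬ Decomposable H

data Walk (G : Graph) : V G → V G → Set where
  here : ∀ {x} → Walk G x x
  step : ∀ {x y z} → E G x y → Walk G y z → Walk G x z

Connected : Graph → Set
Connected G = ∀ x y → Walk G x y

{-# OPTIONS --safe #-}
-- The implication from projective to indecomposable uses the binary polymorphism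
-- ((a , b) , (c , d)) ↦ (a , d) of a product. For the converse every core on 3 to 7 vertices is
-- projective. If ≠ is definable from the edge relation and constants by intersections,
-- compositions and converses, then an idempotent polymorphism f preserves ≠. On the tuples that
-- are a on an initial segment of coordinates and b elsewhere, f switches from b to a at some
-- coordinate, and preservation of ≠ (with at least three values) makes f the projection onto it.
-- Every graph is isomorphic to a one-vertex extension of a representative of a smaller graph, and
-- a computation over these extensions shows that each one either has a non-injective
-- endomorphism or is isomorphic to a graph for which a definition of ≠ is listed.
module Submission where

open import Defs
open import Data.Bool using (Bool; true; false; T; not; _∧_; _∨_; if_then_else_)
import Data.Bool as Bool
open import Data.Bool.ListAction using (all; any)
open import Data.Bool.Properties using (¬-not; T-∧; T-≡; T?)
open import Data.Fin using (Fin; zero; suc; toℕ; fromℕ<; #_)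
open import Data.Fin.Permutation as Perm using (Permutation′; permutation; _⟨$⟩ʳ_; _⟨$⟩ˡ_; inverseˡ; inverseʳ; _∘ₚ_; lift₀)
open import Data.Fin.Properties using (_≟_; all?; any?; toℕ<n; toℕ-fromℕ<; toℕ-injective)
open import Data.List using (List; []; _∷_; [_]; foldr; map; allFin; cartesianProductWith)
open import Data.List.Membership.Propositional using (_∈_; find)
open import Data.List.Membership.Propositional.Properties using (∈-cartesianProductWith⁺; ∈-map⁺)
open import Data.List.Relation.Unary.All as All using ()
open import Data.List.Relation.Unary.All.Properties using (all⁺)
open import Data.List.Relation.Unary.Any using (Any; here; there)
open import Data.Maybe as Maybe using (Maybe; just; nothing; is-just; _<∣>_; _>>=_)
open import Data.Nat using (ℕ; zero; suc; _≤_; _<_; s≤s; _<ᵇ_; _≡ᵇ_; _+_; _*_)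
open import Data.Nat.ListAction using (sum)
open import Data.Nat.Properties using (<⇒<ᵇ; <ᵇ⇒<; ≤-refl; ≤-trans; ≤-antisym; ≤-pred; ≮⇒≥; n≤1+n; m≤n⇒m≤1+n)
open import Data.Product using (∃-syntax; _×_; _,_; proj₁; proj₂)
open import Data.Vec using (Vec; []; _∷_; lookup; tabulate)
open import Data.Vec.Properties using (lookup∘tabulate)
open import Function using (_∘_)
open import Function.Bundles using (Equivalence)
open import Relation.Binary.PropositionalEquality hiding ([_])
open import Relation.Nullary using (¬_; Dec; yes; no; contradiction; does)
open import Relation.Nullary.Decidable using (_×-dec_; _→-dec_; ¬?; dec⇒maybe; decidable-stable; True; toWitness)

private variable n : ℕ

-- Decompositions yield non-projection polymorphisms

projective⇒indecomposable : ∀ {H : Graph} → Projective H → Indecomposable H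
projective⇒indecomposable {H} proj (H₁ , H₂ , (a , a′ , a≢a′) , (b , b′ , b≢b′) , I) =
  absurd (proj 1 band (λ x → proj₁ iso-bij (iso∘g _)))
  where
  open Iso I
  g : V (H₁ ⊗ H₂) → V H
  g p = proj₁ (proj₂ iso-bij p)
  iso∘g : ∀ p → iso (g p) ≡ p
  iso∘g p = proj₂ (proj₂ iso-bij p) refl
  g-injective : ∀ {p q} → g p ≡ g q → p ≡ q
  g-injective {p} {q} e = trans (sym (iso∘g p)) (trans (cong iso e) (iso∘g q))
  g-pres : ∀ {p q} → E (H₁ ⊗ H₂) p q → E H (g p) (g q)
  g-pres {p} {q} e = iso-refl (subst₂ (E (H₁ ⊗ H₂)) (sym (iso∘g p)) (sym (iso∘g q)) e)
  band : Hom (H ^⁺ 1) H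
  band .fun x = g (proj₁ (iso (x zero)) , proj₂ (iso (x (suc zero))))
  band .pres e = g-pres (proj₁ (iso-pres (e zero)) , proj₂ (iso-pres (e (suc zero))))
  pair : V H → V H → Fin 2 → V H
  pair u v zero       = u
  pair u v (suc zero) = v
  band-pair : ∀ p q → fun band (pair (g p) (g q)) ≡ g (proj₁ p , proj₂ q)
  band-pair p q = cong g (cong₂ _,_ (cong proj₁ (iso∘g p)) (cong proj₂ (iso∘g q)))
  absurd : ¬ IsProjection band
  -- For each of the two projections, the chosen pair differs only in the factor that `band` takes
  -- from the other argument.
  absurd (zero , eq) = b≢b′ (cong proj₂ (g-injective
    (trans (sym (eq (pair (g (a , b)) (g (a , b′))))) (band-pair _ _))))
  absurd (suc zero , eq) = a≢a′ (cong proj₁ (g-injective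
    (trans (sym (band-pair _ _)) (eq (pair (g (a , b)) (g (a′ , b)))))))

-- Idempotent operations preserving disequality

third : ∀ {n} → 3 ≤ n → (a b : Fin n) → ∃[ c ] c ≢ a × c ≢ b
third (s≤s (s≤s (s≤s _))) zero          zero          = suc zero , (λ ()) , λ ()
third (s≤s (s≤s (s≤s _))) zero          (suc zero)    = suc (suc zero) , (λ ()) , λ ()
third (s≤s (s≤s (s≤s _))) zero          (suc (suc b)) = suc zero , (λ ()) , λ ()
third (s≤s (s≤s (s≤s _))) (suc zero)    zero          = suc (suc zero) , (λ ()) , λ ()
third (s≤s (s≤s (s≤s _))) (suc (suc a)) zero          = suc zero , (λ ()) , λ ()
third (s≤s (s≤s (s≤s _))) (suc a)       (suc b)       = zero , (λ ()) , λ ()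

module PreservesDisequality {m : ℕ} (3≤n : 3 ≤ n) (f : (Fin m → Fin n) → Fin n)
  (idem : ∀ a → f (λ _ → a) ≡ a)
  (f-≢ : ∀ {x y} → (∀ j → x j ≢ y j) → f x ≢ f y) where

  -- Comparison with the constant tuple at `a`. It follows that `f x` always occurs among the
  -- entries of `x`.
  avoids : ∀ {x a} → (∀ j → x j ≢ a) → f x ≢ a
  avoids {x} {a} x≢a = subst (f x ≢_) (idem a) (f-≢ x≢a)

  cut : ℕ → Fin n → Fin n → Fin m → Fin n
  cut k a b j = if toℕ j <ᵇ k then a else b

  cut-≢ˡ⇒≡ʳ : ∀ k a b → f (cut k a b) ≢ a → f (cut k a b) ≡ b
  cut-≢ˡ⇒≡ʳ k a b ≢a = decidable-stable (_ ≟ _) λ ≢b → avoids (off ≢a ≢b) refl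
    where
    off : ∀ {v} → v ≢ a → v ≢ b → ∀ j → cut k a b j ≢ v
    off v≢a v≢b j with toℕ j <ᵇ k
    ... | true  = v≢a ∘ sym
    ... | false = v≢b ∘ sym

  cut-≢ʳ⇒≡ˡ : ∀ k a b → f (cut k a b) ≢ b → f (cut k a b) ≡ a
  cut-≢ʳ⇒≡ˡ k a b ≢b = decidable-stable (_ ≟ _) λ ≢a → ≢b (cut-≢ˡ⇒≡ʳ k a b ≢a)

  cut-≢ : ∀ k {a b c d} → a ≢ c → b ≢ d → f (cut k a b) ≢ f (cut k c d)
  cut-≢ k {a} {b} {c} {d} a≢c b≢d = f-≢ pointwise
    where
    pointwise : ∀ j → cut k a b j ≢ cut k c d j
    pointwise j with toℕ j <ᵇ k
    ... | true  = a≢c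
    ... | false = b≢d

  Pivot : ℕ → Fin n → Fin n → Set
  Pivot k a b = f (cut k a b) ≡ b × f (cut (suc k) a b) ≡ a

  pivot-rotate : ∀ {k a b c} → a ≢ b → c ≢ a → c ≢ b → Pivot k a b → Pivot k b c
  pivot-rotate {k} {a} {b} {c} a≢b c≢a c≢b (lose , win) =
    cut-≢ˡ⇒≡ʳ k b c (λ e → cut-≢ k (a≢b ∘ sym) c≢b (trans e (sym lose))) ,
    cut-≢ʳ⇒≡ˡ (suc k) b c (λ e → cut-≢ (suc k) (c≢b ∘ sym) c≢a (trans e (sym win′)))
    where
    -- Comparing `cut (suc k) b c` with `cut (suc k) a b` would only exclude the value `a`, so the
    -- argument passes through the pair `c`, `a`.
    win′ : f (cut (suc k) c a) ≡ c
    win′ = cut-≢ʳ⇒≡ˡ (suc k) c a (λ e → cut-≢ (suc k) c≢a a≢b (trans e (sym win)))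

  -- One rotation brings any third value into second place; two rotations through a third value
  -- bring `a` there.
  pivot-at : ∀ {k a b} → a ≢ b → Pivot k a b → ∀ d → ∃[ p ] p ≢ d × Pivot k p d
  pivot-at {a = a} {b} a≢b piv d with d ≟ b
  ... | yes refl = a , a≢b , piv
  ... | no d≢b with d ≟ a
  ...   | no d≢a = b , d≢b ∘ sym , pivot-rotate a≢b d≢a d≢b piv
  ...   | yes refl with third 3≤n a b
  ...     | c , c≢a , c≢b = c , c≢a , pivot-rotate (c≢b ∘ sym) a≢b (c≢a ∘ sym) (pivot-rotate a≢b c≢a c≢b piv)

  pivot-exists : ∀ {a b} → a ≢ b → ∃[ k ] k < m × Pivot k a b
  -- `cut m a b` is only pointwise constant, so `avoids` replaces `idem` here, whereas `cut 0 a b`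
  -- reduces to a constant tuple.
  pivot-exists {a} {b} a≢b = search m ≤-refl (cut-≢ʳ⇒≡ˡ m a b (avoids full))
    where
    full : ∀ j → cut m a b j ≢ b
    full j with toℕ j <ᵇ m | <⇒<ᵇ (toℕ<n j)
    ... | true | _ = a≢b
    search : ∀ k → k ≤ m → f (cut k a b) ≡ a → ∃[ k ] k < m × Pivot k a b
    search zero    _   e = contradiction (trans (sym e) (idem b)) a≢b
    search (suc k) k<m e with f (cut k a b) ≟ a
    ... | yes e′ = search k (≤-trans (n≤1+n k) k<m) e′
    ... | no  ne = k , k<m , cut-≢ˡ⇒≡ʳ k a b ne , e

  -- The four tuples cut k p d, cut (suc k) p d, y and the constants leave no value for f t.
  pivot-coordinate : ∀ {k d p} (k<m : k < m) → p ≢ d → Pivot k p d →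
                     ∀ x → f x ≡ d → x (fromℕ< k<m) ≡ d
  pivot-coordinate {k} {d} {p} k<m p≢d (lose , win) x fx≡d =
    decidable-stable (_ ≟ _) λ xᵢ≢d → f-≢ (t≢y xᵢ≢d) (trans ft≡e (sym fy≡e))
    where
    e   = proj₁ (third 3≤n p d)
    e≢p = proj₁ (proj₂ (third 3≤n p d))
    e≢d = proj₂ (proj₂ (third 3≤n p d))
    flip-d : (u v : Fin n) → Fin m → Fin n
    flip-d u v j with x j ≟ d
    ... | yes _ = u
    ... | no  _ = v
    -- `y` differs from `x` everywhere, which leaves only `e` for `f y`. Before coordinate `k`, `t`
    -- is `y` with `d` and `e` exchanged; at `k` it is `e`, where the assumption on `x` makes `y`
    -- equal to `d`; beyond, it is `p`, which `y` never takes.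
    y t : Fin m → Fin n
    y = flip-d e d
    t j = if toℕ j <ᵇ k then flip-d d e j else cut (suc k) e p j

    y≢x : ∀ j → y j ≢ x j
    y≢x j with x j ≟ d
    ... | yes xⱼ≡d = λ e≡xⱼ → e≢d (trans e≡xⱼ xⱼ≡d)
    ... | no  xⱼ≢d = xⱼ≢d ∘ sym
    y-value : ∀ {v} → v ≢ d → v ≢ e → ∀ j → y j ≢ v
    y-value v≢d v≢e j with x j ≟ d
    ... | yes _ = v≢e ∘ sym
    ... | no  _ = v≢d ∘ sym
    fy≡e : f y ≡ e
    fy≡e = decidable-stable (_ ≟ _) λ ≢e →
      avoids (y-value (λ fy≡d → f-≢ y≢x (trans fy≡d (sym fx≡d))) ≢e) refl

    t≢lose : ∀ j → t j ≢ cut k p d j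
    t≢lose j with toℕ j <ᵇ k
    ... | true with x j ≟ d
    ...   | yes _ = p≢d ∘ sym
    ...   | no  _ = e≢p
    t≢lose j | false with toℕ j <ᵇ suc k
    ...   | true  = e≢d
    ...   | false = p≢d
    t≢win : ∀ j → t j ≢ cut (suc k) p d j
    t≢win j with toℕ j <ᵇ k in j<k
    ... | false with toℕ j <ᵇ suc k
    ...   | true  = e≢p
    ...   | false = p≢d
    t≢win j | true with toℕ j <ᵇ suc k | <⇒<ᵇ (m≤n⇒m≤1+n (<ᵇ⇒< (toℕ j) k (subst T (sym j<k) _)))
    ...   | true | _ with x j ≟ d
    ...     | yes _ = p≢d ∘ sym
    ...     | no  _ = e≢p
    t-value : ∀ {v} → v ≢ p → v ≢ d → v ≢ e → ∀ j → t j ≢ v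
    t-value v≢p v≢d v≢e j with toℕ j <ᵇ k
    ... | true with x j ≟ d
    ...   | yes _ = v≢d ∘ sym
    ...   | no  _ = v≢e ∘ sym
    t-value v≢p v≢d v≢e j | false with toℕ j <ᵇ suc k
    ...   | true  = v≢e ∘ sym
    ...   | false = v≢p ∘ sym
    ft≡e : f t ≡ e
    ft≡e = decidable-stable (_ ≟ _) λ ≢e → avoids (t-value
      (λ ft≡p → f-≢ t≢win (trans ft≡p (sym win)))
      (λ ft≡d → f-≢ t≢lose (trans ft≡d (sym lose))) ≢e) refl

    t≢y : x (fromℕ< k<m) ≢ d → ∀ j → t j ≢ y j
    t≢y xᵢ≢d j with toℕ j <ᵇ k in j≮k
    ... | true with x j ≟ d
    ...   | yes _ = e≢d ∘ sym
    ...   | no  _ = e≢d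
    t≢y xᵢ≢d j | false with toℕ j <ᵇ suc k in j<1+k
    ...   | false with x j ≟ d
    ...     | yes _ = e≢p ∘ sym
    ...     | no  _ = p≢d
    t≢y xᵢ≢d j | false | true with x j ≟ d
    ...     | no  _    = e≢d
    ...     | yes xⱼ≡d = contradiction (trans (cong x (sym j≡i)) xⱼ≡d) xᵢ≢d
      where
      j≡i : j ≡ fromℕ< k<m
      j≡i = toℕ-injective (trans
        (≤-antisym (≤-pred (<ᵇ⇒< (toℕ j) (suc k) (subst T (sym j<1+k) _)))
                   (≮⇒≥ λ j<k → subst T j≮k (<⇒<ᵇ j<k)))
        (sym (toℕ-fromℕ< k<m)))

  -- Rotation changes the two values of a pivot but not its index, so one coordinate serves every
  -- `x`, with the pivot aimed at `f x`.
  projection : ∃[ i ] ∀ x → f x ≡ x i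
  projection = conclude 3≤n
    where
    conclude : 3 ≤ n → ∃[ i ] ∀ x → f x ≡ x i
    conclude (s≤s (s≤s (s≤s _))) with pivot-exists {zero} {suc zero} (λ ())
    ... | k , k<m , piv = fromℕ< k<m , λ x →
      let p , p≢d , piv′ = pivot-at (λ ()) piv (f x)
      in sym (pivot-coordinate k<m p≢d piv′ x refl)

-- Isomorphism of adjacency functions

Adjacency : ℕ → Set
Adjacency n = Fin n → Fin n → Bool

record _≃_ (A B : Adjacency n) : Set where
  field
    perm      : Permutation′ n
    preserves : ∀ i j → B (perm ⟨$⟩ʳ i) (perm ⟨$⟩ʳ j) ≡ A i j
open _≃_

≃-refl : {A : Adjacency n} → A ≃ A
≃-refl .perm = Perm.id
≃-refl .preserves _ _ = refl

≃-trans : {A B C : Adjacency n} → A ≃ B → B ≃ C → A ≃ C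
≃-trans p q .perm = perm p ∘ₚ perm q
≃-trans p q .preserves i j = trans (preserves q _ _) (preserves p i j)

-- Relations definable from edges and constants

data VertexSet (n : ℕ) : Set where
  N    : Fin n → VertexSet n
  N[_] : VertexSet n → VertexSet n
  _∩_  : (S T : VertexSet n) → VertexSet n

data Term (n : ℕ) : Set where
  edge : Term n
  _↾_  : Term n → VertexSet n → Term n
  _∩_  : (R S : Term n) → Term n
  _⨾_  : (R S : Term n) → Term n
  _˘   : Term n → Term n

infixl 8 _↾_
infix  9 _˘
infixr 7 _⨾_
infixr 6 _∩_

module Semantics (A : Adjacency n) where

  _∈ˢ_ : Fin n → VertexSet n → Set
  v ∈ˢ N c     = A v c ≡ true
  v ∈ˢ N[ S ]  = ∃[ w ] A v w ≡ true × w ∈ˢ S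
  v ∈ˢ (S ∩ T) = v ∈ˢ S × v ∈ˢ T

  ⟦_⟧ : Term n → Fin n → Fin n → Set
  ⟦ edge ⟧  u v = A u v ≡ true
  ⟦ R ↾ S ⟧ u v = v ∈ˢ S × ⟦ R ⟧ u v
  ⟦ R ∩ S ⟧ u v = ⟦ R ⟧ u v × ⟦ S ⟧ u v
  ⟦ R ⨾ S ⟧ u v = ∃[ w ] ⟦ R ⟧ u w × ⟦ S ⟧ w v
  ⟦ R ˘ ⟧   u v = ⟦ R ⟧ v u

  _∈ˢ?_ : ∀ v S → Dec (v ∈ˢ S)
  v ∈ˢ? N c     = A v c Bool.≟ true
  v ∈ˢ? N[ S ]  = any? λ w → (A v w Bool.≟ true) ×-dec (w ∈ˢ? S)
  v ∈ˢ? (S ∩ T) = (v ∈ˢ? S) ×-dec (v ∈ˢ? T)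

  ⟦_⟧? : ∀ R u v → Dec (⟦ R ⟧ u v)
  ⟦ edge ⟧?  u v = A u v Bool.≟ true
  ⟦ R ↾ S ⟧? u v = (v ∈ˢ? S) ×-dec ⟦ R ⟧? u v
  ⟦ R ∩ S ⟧? u v = ⟦ R ⟧? u v ×-dec ⟦ S ⟧? u v
  ⟦ R ⨾ S ⟧? u v = any? λ w → ⟦ R ⟧? u w ×-dec ⟦ S ⟧? w v
  ⟦ R ˘ ⟧?   u v = ⟦ R ⟧? v u

  DefinesDisequality : Term n → Set
  DefinesDisequality R = ∀ u v → (⟦ R ⟧ u v → u ≢ v) × (u ≢ v → ⟦ R ⟧ u v)

  definesDisequality? : ∀ R → Dec (DefinesDisequality R)
  definesDisequality? R = all? λ u → all? λ v →
    (⟦ R ⟧? u v →-dec ¬? (u ≟ v)) ×-dec (¬? (u ≟ v) →-dec ⟦ R ⟧? u v)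

open Semantics

-- A polymorphism need not respect pointwise equality of tuples, so constants may only be used
-- as neighbours of literally constant tuples, and terms are evaluated in B along π.
module Preservation (H : FinGraph n) {B : Adjacency n} (iso : adj H ≃ B)
  {k : ℕ} (f : Hom (toGraph H ^⁺ k) (toGraph H)) (idem : Idempotent f) where

  π : Fin n → Fin n
  π = perm iso ⟨$⟩ʳ_

  Tuple : Set
  Tuple = Fin (suc k) → Fin n

  pull : ∀ {u} (v : Fin n) → B (π u) v ≡ true → adj H u (perm iso ⟨$⟩ˡ v) ≡ true
  pull v e = trans (sym (preserves iso _ _)) (trans (cong (B _) (inverseʳ (perm iso))) e)

  push : ∀ {u v} → adj H u v ≡ true → B (π u) (π v) ≡ true
  push = trans (preserves iso _ _)

  set-preserved : ∀ S (x : Tuple) → (∀ j → _∈ˢ_ B (π (x j)) S) → _∈ˢ_ B (π (fun f x)) S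
  set-preserved (N c)   x h = trans (cong (B _) (sym (inverseʳ (perm iso)))) (push
    (subst (λ v → adj H (fun f x) v ≡ true) (idem _) (pres f (λ j → pull c (h j)))))
  set-preserved N[ S ]  x h = π (fun f w) , push (pres f (λ j → pull _ (proj₁ (proj₂ (h j))))) ,
    set-preserved S w λ j → subst (λ v → _∈ˢ_ B v S) (sym (inverseʳ (perm iso))) (proj₂ (proj₂ (h j)))
    where
    w : Tuple
    w j = perm iso ⟨$⟩ˡ proj₁ (h j)
  set-preserved (S ∩ T) x h = set-preserved S x (proj₁ ∘ h) , set-preserved T x (proj₂ ∘ h)

  -- Terms are primitive positive formulas with constants. Witnesses chosen in each coordinate form
  -- a tuple `w`, and `f w` is the witness for the values of `f`.
  preserved : ∀ R (x y : Tuple) → (∀ j → ⟦_⟧ B R (π (x j)) (π (y j))) →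
              ⟦_⟧ B R (π (fun f x)) (π (fun f y))
  preserved edge    x y h = push (pres f λ j → trans (sym (preserves iso _ _)) (h j))
  preserved (R ↾ S) x y h = set-preserved S y (proj₁ ∘ h) , preserved R x y (proj₂ ∘ h)
  preserved (R ∩ S) x y h = preserved R x y (proj₁ ∘ h) , preserved S x y (proj₂ ∘ h)
  preserved (R ⨾ S) x y h = π (fun f w) ,
    preserved R x w (λ j → subst (λ v → ⟦_⟧ B R _ v) (sym (inverseʳ (perm iso))) (proj₁ (proj₂ (h j)))) ,
    preserved S w y (λ j → subst (λ v → ⟦_⟧ B S v _) (sym (inverseʳ (perm iso))) (proj₂ (proj₂ (h j))))
    where
    w : Tuple
    w j = perm iso ⟨$⟩ˡ proj₁ (h j)
  preserved (R ˘)   x y h = preserved R y x h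

disequality-definable⇒projective : 3 ≤ n → (H : FinGraph n) {B : Adjacency n} → adj H ≃ B →
  ∀ R → DefinesDisequality B R → Projective (toGraph H)
disequality-definable⇒projective 3≤n H {B} iso R defines k f idem =
  PreservesDisequality.projection 3≤n (fun f) idem λ {x} {y} x≢y fx≡fy →
    proj₁ (defines _ _)
      (preserved R x y λ j → proj₂ (defines _ _) (x≢y j ∘ π-injective))
      (cong π fx≡fy)
  where
  open Preservation H iso f idem
  π-injective : ∀ {u v} → π u ≡ π v → u ≡ v
  π-injective e = trans (sym (inverseˡ (perm iso))) (trans (cong (perm iso ⟨$⟩ˡ_) e) (inverseˡ (perm iso)))

-- Non-injective endomorphisms

record Collapse (A : Adjacency n) : Set where
  field
    image    : Fin n → Fin n
    respects : ∀ u v → A u v ≡ true → A (image u) (image v) ≡ true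
    collides : ∃[ u ] ∃[ v ] u ≢ v × image u ≡ image v

collapse⇒¬core : (H : FinGraph n) {B : Adjacency n} → adj H ≃ B → Collapse B → ¬ Core (toGraph H)
collapse⇒¬core H {B} iso c core = u≢v (
    trans (sym (inverseʳ (perm iso))) (trans (cong (perm iso ⟨$⟩ʳ_) (proj₁ (core endo) same)) (inverseʳ (perm iso))))
  where
  open Collapse c
  u v : Fin _
  u = proj₁ collides
  v = proj₁ (proj₂ collides)
  u≢v = proj₁ (proj₂ (proj₂ collides))
  back : ∀ {a b} → B a b ≡ true → adj H (perm iso ⟨$⟩ˡ a) (perm iso ⟨$⟩ˡ b) ≡ true
  back e = trans (sym (preserves iso _ _)) (trans (cong₂ B (inverseʳ (perm iso)) (inverseʳ (perm iso))) e)
  endo : Hom (toGraph H) (toGraph H)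
  endo .fun x  = perm iso ⟨$⟩ˡ image (perm iso ⟨$⟩ʳ x)
  endo .pres e = back (respects _ _ (trans (preserves iso _ _) e))
  same : fun endo (perm iso ⟨$⟩ˡ u) ≡ fun endo (perm iso ⟨$⟩ˡ v)
  same = cong (perm iso ⟨$⟩ˡ_) (trans (cong image (inverseʳ (perm iso)))
    (trans (proj₂ (proj₂ (proj₂ collides))) (cong image (sym (inverseʳ (perm iso))))))

-- Enumeration of graphs up to isomorphism

-- In g ▷ r the new vertex is zero, and r is its row of adjacencies to the vertices of g.
data Code : ℕ → Set where
  ∅   : Code 0
  _▷_ : Code n → Vec Bool n → Code (suc n)

adjacent : Code n → Adjacency n
adjacent (g ▷ r) zero    zero    = false
adjacent (g ▷ r) zero    (suc j) = lookup r j
adjacent (g ▷ r) (suc i) zero    = lookup r i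
adjacent (g ▷ r) (suc i) (suc j) = adjacent g i j

encode : Adjacency n → Code n
encode {zero}  A = ∅
encode {suc n} A = encode (λ i j → A (suc i) (suc j)) ▷ tabulate (A zero ∘ suc)

-- Searches for isomorphisms and endomorphisms

firstJust : ∀ {A B : Set} → (A → Maybe B) → List A → Maybe B
firstJust h = foldr (λ a r → h a <∣> r) nothing

Assignment : ℕ → Set
Assignment n = List (Fin n × Fin n)

value : Assignment n → Fin n → Fin n
value []            v = v
value ((u , u′) ∷ a) v = if does (u ≟ v) then u′ else value a v

-- The backtracking searches and the keys are heuristics: only the checks of their results are verified.
assignments : (Assignment n → Fin n → Fin n → Bool) → (Assignment n → Bool) → Maybe (Vec (Fin n) n)
assignments {n} allowed accept = go (allFin n) []
  where
  go : List (Fin n) → Assignment n → Maybe (Vec (Fin n) n)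
  go []       a = if accept a then just (tabulate (value a)) else nothing
  go (v ∷ vs) a = firstJust (λ u → if allowed a v u then go vs ((v , u) ∷ a) else nothing) (allFin n)

Σ : (Fin n → ℕ) → ℕ
Σ {n} h = sum (map h (allFin n))

Keys : ℕ → Set
Keys n = Vec ℕ n

degrees : Code n → Vec ℕ n
degrees g = tabulate λ u → Σ λ v → if adjacent g u v then 1 else 0

-- The degrees are an argument, and not recomputed inside, so that evaluation shares them.
keys : Code n → Vec ℕ n → Keys n
-- On at most 7 vertices degrees are below 8, so the factor 8 packs both summands into one number
-- without overlap.
keys g ds = tabulate λ u → lookup ds u + 8 * Σ λ v →
  if adjacent g u v then lookup ds v * lookup ds v else 0

-- Symmetric in the vertices, hence equal for isomorphic graphs; unequal totals spare the search for
-- an isomorphism.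
total : Keys n → ℕ
total k = Σ λ u → lookup k u * lookup k u * lookup k u

isomorphism : (g : Code n) → Keys n → (h : Code n) → Keys n → Maybe (adjacent g ≃ adjacent h)
isomorphism g kg h kh = assignments allowed (λ _ → true) >>= λ to → check to (inverse to)
  where
  allowed : Assignment _ → Fin _ → Fin _ → Bool
  allowed a v u = (lookup kg v ≡ᵇ lookup kh u) ∧
    all (λ (w , w′) → not (does (w′ ≟ u)) ∧ does (adjacent g v w Bool.≟ adjacent h u w′)) a
  check : Vec (Fin _) _ → Vec (Fin _) _ → Maybe (adjacent g ≃ adjacent h)
  check to from = Maybe.map
      (λ (p , q , r) → record { perm = permutation (lookup to) (lookup from) q p ; preserves = r })
      (dec⇒maybe (
        all? (λ i → lookup from (lookup to i) ≟ i) ×-dec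
        all? (λ i → lookup to (lookup from i) ≟ i) ×-dec
        all? (λ i → all? λ j → adjacent h (lookup to i) (lookup to j) Bool.≟ adjacent g i j)))
  inverse : Vec (Fin _) _ → Vec (Fin _) _
  inverse to = tabulate λ u → value (map (λ v → lookup to v , v) (allFin _)) u

-- Boolean rather than `Dec`, so that evaluating the check builds no evidence; `every-sound`
-- recovers it afterwards.
every : (Fin n → Bool) → Bool
every {zero}  p = true
every {suc n} p = p zero ∧ every (p ∘ suc)

every-sound : ∀ (p : Fin n → Bool) → T (every p) → ∀ i → T (p i)
every-sound p t zero    = proj₁ (Equivalence.to T-∧ t)
every-sound p t (suc i) = every-sound (p ∘ suc) (proj₂ (Equivalence.to (T-∧ {p zero}) t)) i

_⇒_ : Bool → Bool → Bool
false ⇒ b = true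
true  ⇒ b = b

⇒-sound : ∀ a b → T (a ⇒ b) → a ≡ true → b ≡ true
⇒-sound true true _ _ = refl

homomorphic : Code n → Vec (Fin n) n → Bool
homomorphic g m = every λ u → every λ v → adjacent g u v ⇒ adjacent g (lookup m u) (lookup m v)

checkCollapse : (g : Code n) → Vec (Fin n) n → Maybe (Collapse (adjacent g))
checkCollapse g m with T? (homomorphic g m) | any? (λ u → any? λ v → ¬? (u ≟ v) ×-dec (lookup m u ≟ lookup m v))
... | yes h | yes c = just record
  { image    = lookup m
  ; respects = λ u v → ⇒-sound _ _ (every-sound _ (every-sound _ h u) v)
  ; collides = c
  }
... | _ | _ = nothing

-- If every neighbour of u is one of v, then moving u to v is an endomorphism.
fold : (g : Code n) → Maybe (Collapse (adjacent g))
fold {n} g = firstJust (λ u → firstJust (try u) (allFin n)) (allFin n)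
  where
  folds : Fin n → Fin n → Bool
  folds u v = not (does (u ≟ v)) ∧ all (λ w → adjacent g u w ⇒ adjacent g v w) (allFin n)
  move : Fin n → Fin n → Vec (Fin n) n
  move u v = tabulate λ w → if does (w ≟ u) then v else w
  try : Fin n → Fin n → Maybe (Collapse (adjacent g))
  try u v = if folds u v then checkCollapse g (move u v) else nothing

collapse : (g : Code n) → Maybe (Collapse (adjacent g))
collapse g = assignments
  (λ a v u → all (λ (w , w′) → adjacent g v w ⇒ adjacent g u w′) a)
  repeats >>= checkCollapse g
  where
  repeats : Assignment _ → Bool
  repeats []            = false
  repeats ((_ , u) ∷ a) = any (λ (_ , w) → does (u ≟ w)) a ∨ repeats a

-- One-vertex extensions and representatives

rows : ∀ n → List (Vec Bool n)
rows zero    = [ [] ]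
rows (suc n) = cartesianProductWith _∷_ (true ∷ false ∷ []) (rows n)

rows-complete : (r : Vec Bool n) → r ∈ rows n
rows-complete []      = here refl
rows-complete (b ∷ r) = ∈-cartesianProductWith⁺ _∷_ (bit b) (rows-complete r)
  where
  bit : ∀ b → b ∈ true ∷ false ∷ []
  bit true  = here refl
  bit false = there (here refl)

extensions : List (Code n) → List (Code (suc n))
extensions {n} gs = cartesianProductWith _▷_ gs (rows n)

record Keyed (n : ℕ) : Set where
  constructor keyed
  field
    code       : Code n
    vertexKeys : Keys n
    key        : ℕ
open Keyed

attachKeys : Code n → Keys n → Keyed n
attachKeys g k = keyed g k (total k)

attachKey : Code n → Keyed n
attachKey g = attachKeys g (keys g (degrees g))

matches : (g h : Keyed n) → Maybe (adjacent (code g) ≃ adjacent (code h))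
matches g h = if key g ≡ᵇ key h then isomorphism (code g) (vertexKeys g) (code h) (vertexKeys h) else nothing

Represents : List (Keyed n) → Code n → Set
Represents hs g = Any (λ h → adjacent g ≃ adjacent (code h)) hs

represented? : (g : Keyed n) (hs : List (Keyed n)) → Maybe (Represents hs (code g))
represented? g []       = nothing
represented? g (h ∷ hs) = Maybe.map here (matches g h) <∣> Maybe.map there (represented? g hs)

-- The search result is an argument so that the lemmas below can split on it without unfolding the
-- search.
add : ∀ (g : Keyed n) hs → Maybe (Represents hs (code g)) → List (Keyed n)
add g hs (just _) = hs
add g hs nothing  = g ∷ hs

insert : Keyed n → List (Keyed n) → List (Keyed n)
insert g hs = add g hs (represented? g hs)

representatives : List (Code n) → List (Keyed n)
representatives = foldr (insert ∘ attachKey) []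

add-represents : ∀ (g : Keyed n) hs m → Represents (add g hs m) (code g)
add-represents g hs (just r) = r
add-represents g hs nothing  = here ≃-refl

add-extends : ∀ (g : Keyed n) hs m {g′} → Represents hs g′ → Represents (add g hs m) g′
add-extends g hs (just _) r = r
add-extends g hs nothing  r = there r

representatives-complete : ∀ {g : Code n} {gs} → g ∈ gs → Represents (representatives gs) g
representatives-complete {gs = g ∷ gs} (here refl) = add-represents (attachKey g) (representatives gs) _
representatives-complete {g = g′} {g ∷ gs} (there p) =
  add-extends (attachKey g) (representatives gs) _ {g′} (representatives-complete p)

codes : ∀ n → List (Code n)
codes zero    = [ ∅ ]
codes (suc n) = map code (representatives (extensions (codes n)))

delete : FinGraph (suc n) → FinGraph n
delete H .adj x y     = adj H (suc x) (suc y)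
delete H .adj-sym x y = adj-sym H (suc x) (suc y)
delete H .adj-irr x   = adj-irr H (suc x)

-- Vertex zero of `H` becomes the new vertex; its row is transported along `iso` to the vertices of
-- `g`.
extend-≃ : (H : FinGraph (suc n)) {g : Code n} (iso : adj (delete H) ≃ adjacent g) →
           adj H ≃ adjacent (g ▷ tabulate λ j → adj H zero (suc (perm iso ⟨$⟩ˡ j)))
extend-≃ H iso .perm = lift₀ (perm iso)
extend-≃ H iso .preserves zero    zero    = sym (¬-not (adj-irr H zero))
extend-≃ H iso .preserves zero    (suc j) =
  trans (lookup∘tabulate _ (perm iso ⟨$⟩ʳ j)) (cong (adj H zero ∘ suc) (inverseˡ (perm iso)))
extend-≃ H iso .preserves (suc i) zero    =
  trans (lookup∘tabulate _ (perm iso ⟨$⟩ʳ i))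
    (trans (cong (adj H zero ∘ suc) (inverseˡ (perm iso))) (adj-sym H zero (suc i)))
extend-≃ H iso .preserves (suc i) (suc j) = preserves iso i j

extensions-complete : (H : FinGraph (suc n)) → ∃[ g ] g ∈ extensions (codes n) × adj H ≃ adjacent g
codes-complete : (H : FinGraph n) → ∃[ g ] g ∈ codes n × adj H ≃ adjacent g

extensions-complete H with codes-complete (delete H)
... | g , g∈ , iso = _ , ∈-cartesianProductWith⁺ _▷_ g∈ (rows-complete _) , extend-≃ H iso

codes-complete {zero}  H = ∅ , here refl , record { perm = Perm.id ; preserves = λ () }
codes-complete {suc n} H with extensions-complete H
... | g , g∈ , iso with find (representatives-complete g∈)
...   | h , h∈ , iso′ = code h , ∈-map⁺ code h∈ , ≃-trans iso iso′

-- Definitions of disequality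

record Certified (n : ℕ) : Set where
  field
    graph   : Code n
    term    : Term n
    defines : DefinesDisequality (adjacent graph) term
open Certified

certify : (A : Adjacency n) (R : Term n) → {True (definesDisequality? (adjacent (encode A)) R)} → Certified n
certify A R {p} = record { graph = encode A ; term = R ; defines = toWitness p }

-- Asymmetric: encode reads A u v only for u < v, so each pair lists its smaller vertex first.
edges : List (ℕ × ℕ) → Adjacency n
edges es u v = any (λ (a , b) → (a ≡ᵇ toℕ u) ∧ (b ≡ᵇ toℕ v)) es

complete : ∀ n → Adjacency n
complete n u v = not (does (u ≟ v))

-- The loop at `u` is excluded exactly when the `R`-successors of `u` are pairwise non-adjacent.
sandwich : Term n → Term n
sandwich R = R ⨾ edge ⨾ R ˘

-- The terms were found by a computer search: each sandwich contains ≠ and excludes some loops.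
certified : ∀ n → List (Certified n)
certified 3 = certify (complete 3) edge ∷ []
certified 4 = certify (complete 4) edge ∷ []
certified 5 =
  certify (complete 5) edge ∷
  -- The 5-cycle: two vertices are joined by a walk of length 3 exactly when they are distinct.
  certify (edges ((0 , 2) ∷ (0 , 3) ∷ (1 , 3) ∷ (1 , 4) ∷ (2 , 4) ∷ []))
    (sandwich edge) ∷ []
certified 6 =
  certify (complete 6) edge ∷
  -- The wheel with hub 5: the first sandwich excludes the loops on the rim, the second the loop at
  -- the hub.
  certify (edges ((0 , 2) ∷ (0 , 3) ∷ (0 , 5) ∷ (1 , 3) ∷ (1 , 4) ∷
                  (1 , 5) ∷ (2 , 4) ∷ (2 , 5) ∷ (3 , 5) ∷ (4 , 5) ∷ []))
    (sandwich (edge ↾ N (# 5)) ∩ sandwich (edge ↾ (N (# 2) ∩ N (# 3)) ⨾ edge ↾ N (# 5))) ∷ []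
certified 7 =
  certify (complete 7) edge ∷
  certify (edges ((0 , 2) ∷ (0 , 4) ∷ (0 , 5) ∷ (0 , 6) ∷ (1 , 3) ∷ (1 , 4) ∷ (1 , 5) ∷
                  (1 , 6) ∷ (2 , 4) ∷ (2 , 5) ∷ (3 , 5) ∷ (3 , 6) ∷ (4 , 6) ∷ []))
    (sandwich (edge ↾ N (# 5) ⨾ edge ↾ N (# 0)) ∩
     sandwich (edge ↾ N[ N (# 4) ∩ N (# 6) ])) ∷
  certify (edges ((0 , 2) ∷ (0 , 3) ∷ (0 , 5) ∷ (0 , 6) ∷ (1 , 3) ∷ (1 , 4) ∷ (1 , 5) ∷
                  (1 , 6) ∷ (2 , 4) ∷ (2 , 5) ∷ (3 , 5) ∷ (3 , 6) ∷ (4 , 6) ∷ []))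
    (sandwich (edge ↾ N[ N (# 0) ∩ N (# 3) ]) ∩
     sandwich (edge ↾ N[ N (# 3) ∩ N (# 5) ])) ∷
  -- The join of a 5-cycle on 0 to 4 with the edge between 5 and 6.
  certify (edges ((0 , 2) ∷ (0 , 3) ∷ (0 , 5) ∷ (0 , 6) ∷ (1 , 3) ∷ (1 , 4) ∷ (1 , 5) ∷ (1 , 6) ∷
                  (2 , 4) ∷ (2 , 5) ∷ (2 , 6) ∷ (3 , 5) ∷ (3 , 6) ∷ (4 , 5) ∷ (4 , 6) ∷ (5 , 6) ∷ []))
    (sandwich (edge ↾ (N (# 5) ∩ N (# 6))) ∩
     sandwich (edge ↾ (N (# 0) ∩ N (# 2)))) ∷
  -- The 7-cycle, where walks of length 5 play the same part as walks of length 3 in the 5-cycle.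
  certify (edges ((0 , 3) ∷ (0 , 4) ∷ (1 , 4) ∷ (1 , 5) ∷ (2 , 5) ∷ (2 , 6) ∷ (3 , 6) ∷ []))
    (sandwich (edge ⨾ edge)) ∷
  -- The complement of the 7-cycle through 0, 1, 2, 3, 4, 5, 6 in this order.
  certify (edges ((0 , 2) ∷ (0 , 3) ∷ (0 , 4) ∷ (0 , 5) ∷ (1 , 3) ∷ (1 , 4) ∷ (1 , 5) ∷
                  (1 , 6) ∷ (2 , 4) ∷ (2 , 5) ∷ (2 , 6) ∷ (3 , 5) ∷ (3 , 6) ∷ (4 , 6) ∷ []))
    (sandwich (edge ↾ N (# 3) ⨾ edge ↾ N (# 6)) ∩
     sandwich (edge ↾ N[ N (# 1) ∩ N (# 3) ]) ∩
     sandwich (edge ↾ N[ N (# 2) ∩ N (# 4) ]) ∩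
     sandwich (edge ↾ N[ N (# 0) ∩ N (# 5) ])) ∷
  certify (edges ((0 , 3) ∷ (0 , 4) ∷ (0 , 5) ∷ (1 , 3) ∷ (1 , 4) ∷ (1 , 6) ∷
                  (2 , 4) ∷ (2 , 5) ∷ (2 , 6) ∷ (3 , 5) ∷ (3 , 6) ∷ (5 , 6) ∷ []))
    (sandwich (edge ↾ N[ N (# 3) ∩ N (# 5) ]) ∩
     sandwich (edge ↾ N[ N (# 3) ∩ N (# 6) ])) ∷
  certify (edges ((0 , 2) ∷ (0 , 4) ∷ (0 , 5) ∷ (1 , 3) ∷ (1 , 5) ∷ (1 , 6) ∷
                  (2 , 4) ∷ (2 , 6) ∷ (3 , 5) ∷ (3 , 6) ∷ (4 , 6) ∷ []))
    (sandwich ((edge ↾ N (# 4) ⨾ edge ↾ N (# 1) ⨾ edge) ∩ edge) ∩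
     sandwich ((edge ↾ N (# 2) ⨾ edge ↾ N (# 3) ⨾ edge) ∩ edge) ∩
     sandwich ((edge ↾ N (# 4) ⨾ edge ↾ N (# 4) ⨾ edge ↾ (N (# 3) ∩ N[ N (# 0) ]) ⨾ edge) ∩ (edge ↾ N (# 1) ⨾ edge))) ∷
  certify (edges ((0 , 2) ∷ (0 , 4) ∷ (0 , 5) ∷ (0 , 6) ∷ (1 , 3) ∷ (1 , 5) ∷
                  (1 , 6) ∷ (2 , 4) ∷ (2 , 5) ∷ (3 , 5) ∷ (3 , 6) ∷ (4 , 6) ∷ []))
    (sandwich (edge ↾ N[ N (# 5) ∩ N (# 6) ]) ∩
     sandwich (edge ↾ N (# 0) ⨾ edge ↾ N[ N (# 5) ∩ N (# 6) ]) ∩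
     sandwich ((edge ↾ N (# 5) ⨾ edge ↾ N (# 0) ⨾ edge) ∩ edge)) ∷
  certify (edges ((0 , 2) ∷ (0 , 4) ∷ (0 , 5) ∷ (1 , 3) ∷ (1 , 4) ∷ (1 , 5) ∷
                  (1 , 6) ∷ (2 , 4) ∷ (2 , 6) ∷ (3 , 5) ∷ (3 , 6) ∷ (4 , 6) ∷ []))
    (sandwich (edge ↾ N[ N (# 1) ∩ N (# 6) ]) ∩
     sandwich (edge ↾ N[ N (# 4) ∩ N (# 6) ])) ∷
  []
certified _ = []

-- Settling all graphs on 3 to 7 vertices

data Settled (A : Adjacency n) : Set where
  collapsing : Collapse A → Settled A
  projective : ∀ {B} → A ≃ B → ∀ R → DefinesDisequality B R → Settled A

-- The exhaustive search for endomorphisms comes last, for graphs with no fold and no match in the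
-- list.
settle : (g : Code n) → Maybe (Settled (adjacent g))
settle {n} g =
  Maybe.map collapsing (fold g) <∣>
  firstJust (λ c → Maybe.map (λ iso → projective iso (term c) (defines c))
                     (matches (attachKey g) (attachKey (graph c)))) (certified n) <∣>
  Maybe.map collapsing (collapse g)

settled : ∀ {gs : List (Code n)} → all (is-just ∘ settle) gs ≡ true → ∀ {g} → g ∈ gs → Settled (adjacent g)
settled {gs = gs} ok {g} g∈ with settle g | All.lookup (all⁺ (is-just ∘ settle) gs (Equivalence.from T-≡ ok)) g∈
... | just s | _ = s

-- Proved by evaluation for each size; the graphs checked have `suc n` vertices.
settlement : 2 ≤ n → n ≤ 6 → all (is-just ∘ settle) (extensions (codes n)) ≡ true
settlement {0} () _
settlement {1} (s≤s ()) _
settlement {2} _ _ = refl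
settlement {3} _ _ = refl
settlement {4} _ _ = refl
settlement {5} _ _ = refl
settlement {6} _ _ = refl
settlement {suc (suc (suc (suc (suc (suc (suc _))))))} _ (s≤s (s≤s (s≤s (s≤s (s≤s (s≤s ()))))))

core⇒projective : (H : FinGraph n) → 3 ≤ n → n ≤ 7 → Core (toGraph H) → Projective (toGraph H)
-- At the final size the extensions are not reduced to representatives, so they are compared only
-- with the certified graphs and not with one another.
core⇒projective {suc n} H 3≤n@(s≤s 2≤n) (s≤s n≤6) core with extensions-complete H
... | g , g∈ , iso with settled (settlement 2≤n n≤6) g∈
...   | collapsing c         = contradiction core (collapse⇒¬core H iso c)
...   | projective iso′ R ≠R = disequality-definable⇒projective 3≤n H (≃-trans iso iso′) R ≠R

theorem5p1 : ∀ {n : ℕ} (H : FinGraph n) →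
    3 ≤ n → n ≤ 7 →
    Connected (toGraph H) → NonTrivial (toGraph H) → Core (toGraph H) →
    (Projective (toGraph H) → Indecomposable (toGraph H)) ×
    (Indecomposable (toGraph H) → Projective (toGraph H))
theorem5p1 H 3≤n n≤7 _ _ core = projective⇒indecomposable , λ _ → core⇒projective H 3≤n n≤7 core
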